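{- For every planar multigraph $M$ on $n \geq 1$ vertices admitting an embedding into the plane without $2$-faces, $a(M) \geq \frac{n}{4}+\frac{3}{10}$.
   Context: Multigraphs are finite, may have parallel edges, but have no loops. For a multigraph $M$, $a(M)$ denotes the maximum number of vertices of an induced forest in $M$ (a $2$-cycle formed by two parallel edges counts as a cycle). In a plane embedding, each edge is considered to have two sides; the degree of a face $f$ is the number of incidences between $f$ and sides of edges (an edge with the same face on both sides contributes $2$). A $2$-face is a face of degree $2$. -}

module Defs where

open import Data.Nat using (ℕ; zero; suc; _+_; _*_; _≤_; _<_)
open import Data.Bool using (Bool; true; false; not; if_then_else_)
open import Data.Fin using (Fin; zero; suc; toℕ; _≟_; inject₁; fromℕ)
open import Data.Product using (Σ; ∃; ∃-syntax; _×_; _,_; proj₁; proj₂)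
open import Data.Sum using (_⊎_; inj₁; inj₂)
open import Data.Empty using (⊥)
open import Relation.Nullary using (¬_)
open import Relation.Nullary.Decidable using (⌊_⌋)
open import Relation.Binary.PropositionalEquality using (_≡_; _≢_)
open import Relation.Binary.Construct.Closure.ReflexiveTransitive using (Star)
open import Function using (_∘_; _⇔_)

count : ∀ {k} → (Fin k → Bool) → ℕ
count {zero}  P = 0
count {suc k} P = (if P zero then 1 else 0) + count (P ∘ suc)

iter : ∀ {A : Set} → (A → A) → ℕ → A → A
iter f zero    x = x
iter f (suc j) x = f (iter f j x)

record Multigraph (n : ℕ) : Set where
  field
    m     : ℕ
    src   : Fin m → Fin n
    tgt   : Fin m → Fin n
    noLoop : ∀ e → src e ≢ tgt e

module _ {n : ℕ} (M : Multigraph n) where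
  open Multigraph M

  Incident : Fin m → Fin n → Set
  Incident e v = (src e ≡ v) ⊎ (tgt e ≡ v)

  Adjacent : Fin n → Fin n → Set
  Adjacent u v = ∃[ e ] ((src e ≡ u × tgt e ≡ v) ⊎ (src e ≡ v × tgt e ≡ u))

  Connected : Fin n → Fin n → Set
  Connected = Star Adjacent

  degreeV : Fin n → ℕ
  degreeV v = count (λ e → ⌊ src e ≟ v ⌋) + count (λ e → ⌊ tgt e ≟ v ⌋)

  isolated : Fin n → Bool
  isolated v with degreeV v
  ... | zero  = true
  ... | suc _ = false

  -- Cycles and induced forests.  A cycle of length L ≥ 2 is a cyclic
  -- sequence of pairwise distinct vertices v 0 … v (L-1) and pairwise
  -- distinct edges e 0 … e (L-1), where e i joins v i and v (i+1 mod L).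
  -- For L = 2 this is exactly a pair of parallel edges (a 2-cycle).

  Joins : Fin m → Fin n → Fin n → Set
  Joins e x y = (src e ≡ x × tgt e ≡ y) ⊎ (src e ≡ y × tgt e ≡ x)

  record CycleIn (S : Fin n → Bool) : Set where
    field
      L      : ℕ
      L≥1    : 1 ≤ L
      vert   : Fin (suc L) → Fin n
      edge   : Fin (suc L) → Fin m
      vert-inj : ∀ i j → vert i ≡ vert j → i ≡ j
      edge-inj : ∀ i j → edge i ≡ edge j → i ≡ j
      steps  : ∀ (i : Fin L) → Joins (edge (inject₁ i)) (vert (inject₁ i)) (vert (suc i))
      close  : Joins (edge (fromℕ L)) (vert (fromℕ L)) (vert zero)
      inS    : ∀ i → S (vert i) ≡ true

  InducedForest : (Fin n → Bool) → Set
  InducedForest S = ¬ CycleIn S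

  -- Plane embeddings, described combinatorially.
  -- Darts (edge sides / half-edges): (e , true) leaves src e, (e , false) leaves tgt e.

  Dart : Set
  Dart = Fin m × Bool

  tail : Dart → Fin n
  tail (e , true)  = src e
  tail (e , false) = tgt e

  flip : Dart → Dart
  flip (e , b) = (e , not b)

  countD : (Dart → Bool) → ℕ
  countD P = count (λ e → P (e , true)) + count (λ e → P (e , false))

  -- incidence relation between components (Fin k) and plane faces (Fin P):
  -- component c meets plane face p through one of its component faces
  IncAdj : ∀ {k F P} → (Fin F → Fin k) → (Fin n → Fin k) → (Fin F → Fin P)
           → (Fin n → Fin P) → Fin k ⊎ Fin P → Fin k ⊎ Fin P → Set
  IncAdj compF comp pfOrb pfIso (inj₁ c) (inj₂ p) =
      (∃[ f ] (compF f ≡ c × pfOrb f ≡ p))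
    ⊎ (∃[ v ] (isolated v ≡ true × comp v ≡ c × pfIso v ≡ p))
  IncAdj compF comp pfOrb pfIso (inj₂ p) (inj₁ c) =
    IncAdj compF comp pfOrb pfIso (inj₁ c) (inj₂ p)
  IncAdj _ _ _ _ (inj₁ _) (inj₁ _) = ⊥
  IncAdj _ _ _ _ (inj₂ _) (inj₂ _) = ⊥

  record PlaneEmbedding : Set where
    field
      -- rotation system: σ permutes the darts, cyclically around each vertex
      σ σ⁻   : Dart → Dart
      σσ⁻    : ∀ d → σ (σ⁻ d) ≡ d
      σ⁻σ    : ∀ d → σ⁻ (σ d) ≡ d
      σ-tail : ∀ d → tail (σ d) ≡ tail d
      σ-cyc  : ∀ d d′ → tail d ≡ tail d′ → ∃[ j ] iter σ j d ≡ d′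

    -- face permutation: its orbits are the facial boundary walks
    φ : Dart → Dart
    φ = λ d → σ (flip d)

    field
      k         : ℕ
      comp      : Fin n → Fin k
      comp-surj : ∀ c → ∃[ v ] comp v ≡ c
      comp-spec : ∀ u v → (comp u ≡ comp v) ⇔ Connected u v
      F        : ℕ
      orb      : Dart → Fin F
      rep      : Fin F → Dart
      orb-rep  : ∀ f → orb (rep f) ≡ f
      orb-spec : ∀ d d′ → (orb d ≡ orb d′) ⇔ (∃[ j ] iter φ j d ≡ d′)

    compF : Fin F → Fin k
    compF = λ f → comp (tail (rep f))

    -- faces of each component embedded on its own sphere:
    -- its facial walks, plus one face for an isolated vertex
    Vc : Fin k → ℕ
    Vc = λ c → count (λ v → ⌊ comp v ≟ c ⌋)
    Ec : Fin k → ℕ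
    Ec = λ c → count (λ e → ⌊ comp (src e) ≟ c ⌋)
    Fc : Fin k → ℕ
    Fc = λ c → count (λ f → ⌊ compF f ≟ c ⌋)
               + count (λ v → isolated v Data.Bool.∧ ⌊ comp v ≟ c ⌋)

    field
      -- each component is embedded in the sphere (genus 0, Euler's formula)
      euler : ∀ c → Vc c + Fc c ≡ Ec c + 2
      -- plane faces, labelled by Fin P; each component face (facial walk,
      -- or the face around an isolated vertex) lies in exactly one plane face
      P     : ℕ
      pfOrb : Fin F → Fin P
      pfIso : Fin n → Fin P   -- only meaningful on isolated vertices

    -- bipartite incidence multigraph between components and plane faces,
    -- one edge per component face
    BAdj : Fin k ⊎ Fin P → Fin k ⊎ Fin P → Set
    BAdj = IncAdj compF comp pfOrb pfIso

    field
      tree-connected : ∀ x y → Star BAdj x y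
      tree-count     : F + count isolated + 1 ≡ k + P

    faceDegree : Fin P → ℕ
    faceDegree p = countD (λ d → ⌊ pfOrb (orb d) ≟ p ⌋)

    No2Faces : Set
    No2Faces = ∀ p → faceDegree p ≢ 2

  size : (Fin n → Bool) → ℕ
  size = count

{-# OPTIONS --safe #-}
-- Let S₁ be an inclusion-maximal induced forest, S₂ one in the rest, and so on.
-- Every vertex left over at a stage sends at least two edges into the forest just
-- removed, so as in Turán's theorem, induction on the number k of stages gives
-- 2kn ≤ k(k+1) a(M) + m.  Take k = 4: 8n ≤ 20 a(M) + m.  Without 2-faces all face
-- degrees are at least 3 as soon as there is an edge, so Euler's formula yields
-- m ≤ 3n − 6 and hence 5n + 6 ≤ 20 a(M).

module Submission where

open import Defs
open import Data.Nat using (ℕ; zero; suc; _+_; _*_; _≤_; z≤n; s≤s; _≤?_)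
open import Data.Nat.Properties hiding (_≟_)
open import Data.Nat.Tactic.RingSolver using (solve-∀)
open import Algebra.Properties.Semiring.Sum +-*-semiring
  using (sum; sum-cong-≗; sum-replicate-zero; ∑-distrib-+; ∑-comm; *-distribˡ-sum)
open import Data.Bool using (Bool; true; false; not; if_then_else_; _∧_; _∨_)
open import Data.Bool.Properties using (∧-zeroʳ)
open import Data.Fin using (Fin; zero; suc; _≟_; inject₁; fromℕ)
open import Data.Fin.Properties using (any?)
  renaming (suc-injective to suc-injectiveF)
open import Data.Fin.Relation.Unary.Top using (view; ‵fromℕ; ‵inject₁)
open import Data.List using (List; []; _∷_; allFin)
open import Data.List.Membership.Propositional using (_∈_)
open import Data.List.Membership.Propositional.Properties using (∈-allFin)
open import Data.List.Relation.Unary.Any using (here; there)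
open import Data.Product using (∃-syntax; _×_; _,_)
open import Data.Sum using (_⊎_; inj₁; inj₂)
open import Function using (_∘_; Equivalence)
open import Relation.Nullary using (¬_; yes; no; contradiction)
open import Relation.Nullary.Decidable using (⌊_⌋)
open import Relation.Binary.Construct.Closure.ReflexiveTransitive using (Star; ε; _◅_)
open import Relation.Binary.PropositionalEquality
  using (_≡_; _≢_; refl; sym; trans; cong; cong₂; subst)

-- Indicators, finite sums and counting.

𝟙 : Bool → ℕ
𝟙 b = if b then 1 else 0

≟-true : ∀ {k} {i j : Fin k} → i ≡ j → ⌊ i ≟ j ⌋ ≡ true
≟-true {i = i} {j} i≡j with i ≟ j
... | yes _  = refl
... | no i≢j = contradiction i≡j i≢j

≟-true⁻¹ : ∀ {k} {i j : Fin k} → ⌊ i ≟ j ⌋ ≡ true → i ≡ j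
≟-true⁻¹ {i = i} {j} eq with yes i≡j ← i ≟ j = i≡j

≟-suc : ∀ {k} (i j : Fin k) → ⌊ suc i ≟ suc j ⌋ ≡ ⌊ i ≟ j ⌋
≟-suc i j with i ≟ j
... | yes _ = refl
... | no _  = refl

sum-mono-≤ : ∀ {k} {f g : Fin k → ℕ} → (∀ i → f i ≤ g i) → sum f ≤ sum g
sum-mono-≤ {zero}  f≤g = z≤n
sum-mono-≤ {suc k} f≤g = +-mono-≤ (f≤g zero) (sum-mono-≤ (f≤g ∘ suc))

*≤sum : ∀ {k} {f : Fin k → ℕ} c → (∀ i → c ≤ f i) → k * c ≤ sum f
*≤sum {zero}  c c≤f = z≤n
*≤sum {suc k} c c≤f = +-mono-≤ (c≤f zero) (*≤sum c (c≤f ∘ suc))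

sum-const : ∀ k c → sum {k} (λ _ → c) ≡ k * c
sum-const zero    c = refl
sum-const (suc k) c = cong (c +_) (sum-const k c)

sum-≟-* : ∀ {k} (j : Fin k) (f : Fin k → ℕ) → sum (λ i → 𝟙 ⌊ j ≟ i ⌋ * f i) ≡ f j
sum-≟-* {suc k} zero    f =
  trans (cong (1 * f zero +_) (sum-replicate-zero k))
        (trans (+-identityʳ _) (*-identityˡ (f zero)))
sum-≟-* {suc k} (suc j) f =
  trans (sum-cong-≗ (λ i → cong (λ b → 𝟙 b * f (suc i)) (≟-suc j i))) (sum-≟-* j (f ∘ suc))

count≡sum : ∀ {k} (P : Fin k → Bool) → count P ≡ sum (𝟙 ∘ P)
count≡sum {zero}  P = refl
count≡sum {suc k} P = cong (𝟙 (P zero) +_) (count≡sum (P ∘ suc))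

count-true : ∀ k → count {k} (λ _ → true) ≡ k
count-true zero    = refl
count-true (suc k) = cong suc (count-true k)

count-mono-≤ : ∀ {k} {P Q : Fin k → Bool} → (∀ i → P i ≡ true → Q i ≡ true) → count P ≤ count Q
count-mono-≤ {zero}          P⊆Q = z≤n
count-mono-≤ {suc k} {P} {Q} P⊆Q = +-mono-≤ (head (P zero) refl) (count-mono-≤ (P⊆Q ∘ suc))
  where
  head : ∀ b → P zero ≡ b → 𝟙 b ≤ 𝟙 (Q zero)
  head false _  = z≤n
  head true  eq = ≤-reflexive (cong 𝟙 (sym (P⊆Q zero eq)))

1≤count : ∀ {k} (P : Fin k → Bool) i → P i ≡ true → 1 ≤ count P
1≤count P zero    Pi rewrite Pi = s≤s z≤n
1≤count P (suc i) Pi = ≤-trans (1≤count (P ∘ suc) i Pi) (m≤n+m _ _)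

2≤count : ∀ {k} (P : Fin k → Bool) i j → i ≢ j → P i ≡ true → P j ≡ true → 2 ≤ count P
2≤count P zero    zero    i≢j _  _  = contradiction refl i≢j
2≤count P zero    (suc j) i≢j Pi Pj rewrite Pi = s≤s (1≤count (P ∘ suc) j Pj)
2≤count P (suc i) zero    i≢j Pi Pj rewrite Pj = s≤s (1≤count (P ∘ suc) i Pi)
2≤count P (suc i) (suc j) i≢j Pi Pj =
  ≤-trans (2≤count (P ∘ suc) i j (i≢j ∘ cong suc) Pi Pj) (m≤n+m _ _)

-- Exchange of summation: each index lies in exactly one fibre of `g`. For `A` constantly true the
-- conjunction computes away, so this one lemma totals vertices, edges and facial walks over
-- components as well as darts over faces.
count-fibres : ∀ {k l} (A : Fin k → Bool) (g : Fin k → Fin l)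
             → sum (λ c → count (λ i → A i ∧ ⌊ g i ≟ c ⌋)) ≡ count A
count-fibres {k} {l} A g = begin-equality
  sum (λ c → count (λ i → A i ∧ ⌊ g i ≟ c ⌋))
    ≡⟨ sum-cong-≗ (λ c → count≡sum (λ i → A i ∧ ⌊ g i ≟ c ⌋)) ⟩
  sum (λ c → sum (λ i → 𝟙 (A i ∧ ⌊ g i ≟ c ⌋)))
    ≡⟨ ∑-comm {l} {k} (λ c i → 𝟙 (A i ∧ ⌊ g i ≟ c ⌋)) ⟩
  sum (λ i → sum (λ c → 𝟙 (A i ∧ ⌊ g i ≟ c ⌋)))
    ≡⟨ sum-cong-≗ (λ i → trans (sum-cong-≗ (λ c → 𝟙-∧ (A i) ⌊ g i ≟ c ⌋)) (sum-≟-* (g i) (λ _ → 𝟙 (A i)))) ⟩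
  sum (𝟙 ∘ A)
    ≡⟨ count≡sum A ⟨
  count A ∎
  where
  open ≤-Reasoning
  𝟙-∧ : ∀ a b → 𝟙 (a ∧ b) ≡ 𝟙 b * 𝟙 a
  𝟙-∧ false false = refl
  𝟙-∧ false true  = refl
  𝟙-∧ true  false = refl
  𝟙-∧ true  true  = refl

-- Vertex sets as Boolean predicates.

_⊆_ : ∀ {n} → (Fin n → Bool) → (Fin n → Bool) → Set
S ⊆ T = ∀ v → S v ≡ true → T v ≡ true

_∖_ : ∀ {n} → (Fin n → Bool) → (Fin n → Bool) → Fin n → Bool
(T ∖ S) v = T v ∧ not (S v)

insert : ∀ {n} → (Fin n → Bool) → Fin n → Fin n → Bool
insert S v w = ⌊ w ≟ v ⌋ ∨ S w

insert-other : ∀ {n} (S : Fin n → Bool) v w → insert S v w ≡ true → w ≢ v → S w ≡ true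
insert-other S v w eq w≢v with w ≟ v
... | yes w≡v = contradiction w≡v w≢v
... | no _    = eq

⊆-insert : ∀ {n} (S : Fin n → Bool) v → S ⊆ insert S v
⊆-insert S v w Sw with w ≟ v
... | yes _ = refl
... | no _  = Sw

count-∖ : ∀ {n} {S T : Fin n → Bool} → S ⊆ T → count S + count (T ∖ S) ≡ count T
count-∖ {S = S} {T} S⊆T = begin-equality
  count S + count (T ∖ S)               ≡⟨ cong₂ _+_ (count≡sum S) (count≡sum (T ∖ S)) ⟩
  sum (𝟙 ∘ S) + sum (𝟙 ∘ (T ∖ S))       ≡⟨ ∑-distrib-+ (𝟙 ∘ S) (𝟙 ∘ (T ∖ S)) ⟨
  sum (λ v → 𝟙 (S v) + 𝟙 ((T ∖ S) v))   ≡⟨ sum-cong-≗ (λ v → pointwise (S v) (T v) (S⊆T v)) ⟩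
  sum (𝟙 ∘ T)                           ≡⟨ count≡sum T ⟨
  count T                               ∎
  where
  open ≤-Reasoning
  pointwise : ∀ s t → (s ≡ true → t ≡ true) → 𝟙 s + 𝟙 (t ∧ not s) ≡ 𝟙 t
  pointwise false false _ = refl
  pointwise false true  _ = refl
  pointwise true  false h with () ← h refl
  pointwise true  true  _ = refl

-- Induced forests and the Turán-type bound.

module _ {n : ℕ} (M : Multigraph n) where
  open Multigraph M

  joinsTo : (Fin n → Bool) → Fin n → Fin m → Bool
  joinsTo S v e = (⌊ src e ≟ v ⌋ ∧ S (tgt e)) ∨ (⌊ tgt e ≟ v ⌋ ∧ S (src e))

  -- Edges are counted, not neighbours: two parallel edges to one vertex of `S` already close a
  -- 2-cycle and must count twice.
  degreeInto : (Fin n → Bool) → Fin n → ℕ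
  degreeInto S v = count (joinsTo S v)

  edgesIn : (Fin n → Bool) → ℕ
  edgesIn T = count (λ e → T (src e) ∧ T (tgt e))

  Joins-sym : ∀ {e x y} → Joins M e x y → Joins M e y x
  Joins-sym (inj₁ p) = inj₂ p
  Joins-sym (inj₂ p) = inj₁ p

  Joins⇒joinsTo : ∀ {S v e w} → Joins M e v w → S w ≡ true → joinsTo S v e ≡ true
  Joins⇒joinsTo {e = e} (inj₁ (refl , refl)) Sw rewrite ≟-true (refl {x = src e}) | Sw = refl
  Joins⇒joinsTo {S} {v} {e} (inj₂ (refl , refl)) Sw
    rewrite ≟-true (refl {x = tgt e}) | Sw with ⌊ src e ≟ tgt e ⌋ ∧ S (tgt e)
  ... | true  = refl
  ... | false = refl

  joinsTo-mono : ∀ {S S′} v → S ⊆ S′ → ∀ e → joinsTo S v e ≡ true → joinsTo S′ v e ≡ true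
  joinsTo-mono {S} {S′} v S⊆S′ e =
    mono ⌊ src e ≟ v ⌋ ⌊ tgt e ≟ v ⌋ (S⊆S′ (tgt e)) (S⊆S′ (src e))
    where
    mono : ∀ a b {c d c′ d′} → (c ≡ true → c′ ≡ true) → (d ≡ true → d′ ≡ true)
         → (a ∧ c) ∨ (b ∧ d) ≡ true → (a ∧ c′) ∨ (b ∧ d′) ≡ true
    mono false true  _ h eq = h eq
    mono true  b {true}          g _ eq rewrite g refl = refl
    mono true  true  {false} {d} {c′} g h eq rewrite h eq with c′
    ... | true  = refl
    ... | false = refl
    mono true  false {false} g h ()

  module _ {S : Fin n → Bool} (C : CycleIn M S) where
    open CycleIn C

    edgeAfter : ∀ i → ∃[ j ] (j ≢ i × Joins M (edge i) (vert i) (vert j))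
    edgeAfter i with view i
    ... | ‵inject₁ j = suc j , suc≢inject₁ j , steps j
      where
      suc≢inject₁ : ∀ {k} (j : Fin k) → suc j ≢ inject₁ j
      suc≢inject₁ (suc j) eq = suc≢inject₁ j (suc-injectiveF eq)
    ... | ‵fromℕ = zero , zero≢fromℕ L≥1 , close
      where
      zero≢fromℕ : ∀ {k} → 1 ≤ k → zero ≢ fromℕ k
      zero≢fromℕ (s≤s _) ()

    -- Edge number `j` runs from vertex number `j` to its successor, so one index names both the
    -- edge entering vertex `i` and its other end. At index zero the predecessor is the last vertex,
    -- which differs from the first because `L≥1`.
    edgeBefore : ∀ i → ∃[ j ] (j ≢ i × Joins M (edge j) (vert i) (vert j))
    edgeBefore zero    = fromℕ L , fromℕ≢zero L≥1 , Joins-sym close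
      where
      fromℕ≢zero : ∀ {k} → 1 ≤ k → fromℕ k ≢ zero
      fromℕ≢zero (s≤s _) ()
    edgeBefore (suc j) = inject₁ j , inject₁≢suc j , Joins-sym (steps j)
      where
      inject₁≢suc : ∀ {k} (j : Fin k) → inject₁ j ≢ suc j
      inject₁≢suc (suc j) eq = inject₁≢suc j (suc-injectiveF eq)

  -- A cycle avoiding `v` would lie in `S`. A cycle through `v` enters and leaves it by two distinct
  -- edges whose other ends lie in `S`, more than the degree bound allows.
  forest-insert : ∀ {S v} → InducedForest M S → degreeInto S v ≤ 1 → InducedForest M (insert S v)
  forest-insert {S} {v} forest deg≤1 C with any? (λ i → CycleIn.vert C i ≟ v)
  ... | no v∉C = forest record
    { CycleIn C using (L; L≥1; vert; edge; vert-inj; edge-inj; steps; close)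
    ; inS = λ i → insert-other S v _ (CycleIn.inS C i) (λ eq → v∉C (i , eq)) }
  ... | yes (i , vᵢ≡v) = <⇒≱ twice deg≤1
    where
    open CycleIn C
    others : ∀ {j} → j ≢ i → S (vert j) ≡ true
    others {j} j≢i = insert-other S v _ (inS j) (λ vⱼ≡v → j≢i (vert-inj j i (trans vⱼ≡v (sym vᵢ≡v))))
    from-v : ∀ {e w} → Joins M e (vert i) w → Joins M e v w
    from-v = subst (λ u → Joins M _ u _) vᵢ≡v
    twice : 2 ≤ degreeInto S v
    twice with edgeAfter C i | edgeBefore C i
    ... | a , a≢i , ia | b , b≢i , ib =
      -- Distinctness has to come from the edges: in a 2-cycle the neighbours `a` and `b` coincide.
      2≤count (joinsTo S v) (edge i) (edge b) (b≢i ∘ sym ∘ edge-inj i b)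
        (Joins⇒joinsTo {S} (from-v ia) (others a≢i)) (Joins⇒joinsTo {S} (from-v ib) (others b≢i))

  -- Greedy construction: a vertex of `T` is added when it sends at most one edge into the forest
  -- built so far. Only the degree condition on the rest is recorded, since this is what the
  -- counting uses. It follows from inclusion-maximality by `forest-insert` but is weaker: a
  -- rejected vertex may send its two edges into different trees.
  maximalForest : ∀ T (vs : List (Fin n)) →
    ∃[ S ] (InducedForest M S × S ⊆ T
      × (∀ v → v ∈ vs → (T ∖ S) v ≡ true → 2 ≤ degreeInto S v))
  maximalForest T [] = (λ _ → false) , (λ C → contradiction (CycleIn.inS C zero) λ ()) , (λ _ ()) , (λ _ ())
  maximalForest T (v ∷ vs) with maximalForest T vs
  ... | S , forest , S⊆T , max with T v in Tv | degreeInto S v ≤? 1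
  ... | false | _ = S , forest , S⊆T , max′
    where
    max′ : ∀ w → w ∈ v ∷ vs → (T ∖ S) w ≡ true → 2 ≤ degreeInto S w
    max′ w (here refl) eq rewrite Tv with () ← eq
    max′ w (there w∈vs) eq = max w w∈vs eq
  ... | true | no deg≰1 = S , forest , S⊆T , max′
    where
    max′ : ∀ w → w ∈ v ∷ vs → (T ∖ S) w ≡ true → 2 ≤ degreeInto S w
    max′ w (here refl) _ = ≰⇒> deg≰1
    max′ w (there w∈vs) eq = max w w∈vs eq
  ... | true | yes deg≤1 = insert S v , forest-insert forest deg≤1 , ⊆T , max′
    where
    ⊆T : insert S v ⊆ T
    ⊆T w eq with w ≟ v
    ... | yes refl = Tv
    ... | no _     = S⊆T w eq
    max′ : ∀ w → w ∈ v ∷ vs → (T ∖ insert S v) w ≡ true → 2 ≤ degreeInto (insert S v) w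
    max′ w (here refl) eq rewrite ≟-true (refl {x = v}) | ∧-zeroʳ (T v) with () ← eq
    -- Vertices treated earlier keep their bound: enlarging the forest shrinks the rest and can only
    -- raise degrees into it.
    max′ w (there w∈vs) eq =
      ≤-trans (max w w∈vs (shrink (T w) ⌊ w ≟ v ⌋ (S w) eq)) (count-mono-≤ (joinsTo-mono w (⊆-insert S v)))
      where
      shrink : ∀ t a s → t ∧ not (a ∨ s) ≡ true → t ∧ not s ≡ true
      shrink true false s eq = eq

  -- Double counting of the edges between `S` and the rest `R` of `T`: every vertex of `R` accounts
  -- for at least two, and none of them lies inside `R`, so they add to the edges inside `R` without
  -- overlap.
  edgesIn-∖ : ∀ {S T} → S ⊆ T → (∀ v → (T ∖ S) v ≡ true → 2 ≤ degreeInto S v)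
            → edgesIn (T ∖ S) + 2 * count (T ∖ S) ≤ edgesIn T
  edgesIn-∖ {S} {T} S⊆T deg≥2 = begin
    edgesIn R + 2 * count R
      ≡⟨ cong₂ _+_ (count≡sum (λ e → R (src e) ∧ R (tgt e))) (trans (cong (2 *_) (count≡sum R)) (*-distribˡ-sum 2 (𝟙 ∘ R))) ⟩
    sum inner + sum (λ v → 2 * 𝟙 (R v))
      ≤⟨ +-monoʳ-≤ (sum inner) (sum-mono-≤ (λ v → weighted v (R v) refl)) ⟩
    sum inner + sum (λ v → 𝟙 (R v) * sum (λ e → ends e v))
      ≡⟨ cong (sum inner +_) (trans (sum-cong-≗ (λ v → *-distribˡ-sum (𝟙 (R v)) (λ e → ends e v)))
           (∑-comm (λ v e → 𝟙 (R v) * ends e v))) ⟩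
    sum inner + sum (λ e → sum (λ v → 𝟙 (R v) * ends e v))
      ≡⟨ cong (sum inner +_) (sum-cong-≗ perEdge) ⟩
    sum inner + sum (λ e → 𝟙 (R (src e)) * 𝟙 (S (tgt e)) + 𝟙 (R (tgt e)) * 𝟙 (S (src e)))
      ≡⟨ ∑-distrib-+ inner _ ⟨
    sum (λ e → inner e + (𝟙 (R (src e)) * 𝟙 (S (tgt e)) + 𝟙 (R (tgt e)) * 𝟙 (S (src e))))
      ≤⟨ sum-mono-≤ (λ e → disjoint (S (src e)) (T (src e)) (S (tgt e)) (T (tgt e)) (S⊆T _) (S⊆T _)) ⟩
    sum (λ e → 𝟙 (T (src e) ∧ T (tgt e)))
      ≡⟨ count≡sum (λ e → T (src e) ∧ T (tgt e)) ⟨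
    edgesIn T ∎
    where
    open ≤-Reasoning
    R = T ∖ S
    inner : Fin m → ℕ
    inner e = 𝟙 (R (src e) ∧ R (tgt e))
    -- A linear majorant of the indicator of `joinsTo S v e`, with the disjunction replaced by a
    -- sum. Linearity lets the sum over `v` collapse to the two ends of `e`.
    ends : Fin m → Fin n → ℕ
    ends e v = 𝟙 ⌊ src e ≟ v ⌋ * 𝟙 (S (tgt e)) + 𝟙 ⌊ tgt e ≟ v ⌋ * 𝟙 (S (src e))

    𝟙-∨∧ : ∀ a b c d → 𝟙 ((a ∧ b) ∨ (c ∧ d)) ≤ 𝟙 a * 𝟙 b + 𝟙 c * 𝟙 d
    𝟙-∨∧ false b false d = z≤n
    𝟙-∨∧ false b true  d = m≤m+n _ 0
    𝟙-∨∧ true  true  c d = s≤s z≤n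
    𝟙-∨∧ true  false false d = z≤n
    𝟙-∨∧ true  false true  d = m≤m+n _ 0

    weighted : ∀ v b → R v ≡ b → 2 * 𝟙 b ≤ 𝟙 b * sum (λ e → ends e v)
    weighted v false _  = z≤n
    weighted v true  Rv = begin
      2                        ≤⟨ deg≥2 v Rv ⟩
      degreeInto S v           ≡⟨ count≡sum (joinsTo S v) ⟩
      sum (𝟙 ∘ joinsTo S v)    ≤⟨ sum-mono-≤ (λ e → 𝟙-∨∧ ⌊ src e ≟ v ⌋ (S (tgt e)) ⌊ tgt e ≟ v ⌋ (S (src e))) ⟩
      sum (λ e → ends e v)     ≡⟨ *-identityˡ _ ⟨
      1 * sum (λ e → ends e v) ∎

    perEdge : ∀ e → sum (λ v → 𝟙 (R v) * ends e v)
            ≡ 𝟙 (R (src e)) * 𝟙 (S (tgt e)) + 𝟙 (R (tgt e)) * 𝟙 (S (src e))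
    perEdge e = begin-equality
      sum (λ v → 𝟙 (R v) * ends e v)
        ≡⟨ sum-cong-≗ (λ v → rearrange (𝟙 (R v)) (𝟙 ⌊ src e ≟ v ⌋) (𝟙 (S (tgt e))) (𝟙 ⌊ tgt e ≟ v ⌋) (𝟙 (S (src e)))) ⟩
      sum (λ v → 𝟙 ⌊ src e ≟ v ⌋ * (𝟙 (R v) * 𝟙 (S (tgt e))) + 𝟙 ⌊ tgt e ≟ v ⌋ * (𝟙 (R v) * 𝟙 (S (src e))))
        ≡⟨ ∑-distrib-+ (λ v → 𝟙 ⌊ src e ≟ v ⌋ * (𝟙 (R v) * 𝟙 (S (tgt e)))) _ ⟩
      sum (λ v → 𝟙 ⌊ src e ≟ v ⌋ * (𝟙 (R v) * 𝟙 (S (tgt e))))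
        + sum (λ v → 𝟙 ⌊ tgt e ≟ v ⌋ * (𝟙 (R v) * 𝟙 (S (src e))))
        ≡⟨ cong₂ _+_ (sum-≟-* (src e) (λ v → 𝟙 (R v) * 𝟙 (S (tgt e))))
                     (sum-≟-* (tgt e) (λ v → 𝟙 (R v) * 𝟙 (S (src e)))) ⟩
      𝟙 (R (src e)) * 𝟙 (S (tgt e)) + 𝟙 (R (tgt e)) * 𝟙 (S (src e)) ∎
      where
      rearrange : ∀ r a b c d → r * (a * b + c * d) ≡ a * (r * b) + c * (r * d)
      rearrange = solve-∀

    -- The unprimed variables record membership of one end of an edge in `S` and `T`, the primed
    -- ones that of the other end. The three summands say "both ends in `R`" and "one end in `R`,
    -- the other in `S`" in either order; these exclude each other.
    disjoint : ∀ s t s′ t′ → (s ≡ true → t ≡ true) → (s′ ≡ true → t′ ≡ true)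
      → 𝟙 ((t ∧ not s) ∧ (t′ ∧ not s′)) + (𝟙 (t ∧ not s) * 𝟙 s′ + 𝟙 (t′ ∧ not s′) * 𝟙 s) ≤ 𝟙 (t ∧ t′)
    disjoint true  false _     _     h _ with () ← h refl
    disjoint _     _     true  false _ h with () ← h refl
    disjoint true  true  true  true  _ _ = z≤n
    disjoint true  true  false true  _ _ = s≤s z≤n
    disjoint true  true  false false _ _ = z≤n
    disjoint false true  true  true  _ _ = s≤s z≤n
    disjoint false true  false true  _ _ = s≤s z≤n
    disjoint false true  false false _ _ = z≤n
    disjoint false false true  true  _ _ = z≤n
    disjoint false false false true  _ _ = z≤n
    disjoint false false false false _ _ = z≤n

  -- The coefficient `k * suc k` is 2 + 4 + ... + 2k: the forest removed with `i` stages to go,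
  -- itself included, is charged 2i times its size.
  turánForest : ∀ k T →
    ∃[ S ] (InducedForest M S × 2 * k * count T ≤ k * suc k * count S + edgesIn T)
  -- For `k = 0` the left side vanishes, so any forest serves; the empty list yields the empty one.
  turánForest zero T with maximalForest T []
  ... | S , forest , _ = S , forest , z≤n
  turánForest (suc k) T with maximalForest T (allFin n)
  ... | S₁ , forest₁ , S₁⊆T , max with turánForest k (T ∖ S₁)
  ... | S₂ , forest₂ , bound₂ = larger (≤-total (count S₁) (count S₂))
    where
    -- `s` stands for the larger of the two sizes, so one computation serves whichever forest is
    -- returned.
    bound : ∀ s → count S₁ ≤ s → count S₂ ≤ s
          → 2 * suc k * count T ≤ suc k * suc (suc k) * s + edgesIn T
    bound s S₁≤s S₂≤s = begin
      2 * suc k * count T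
        ≡⟨ cong (2 * suc k *_) (count-∖ {S = S₁} {T} S₁⊆T) ⟨
      2 * suc k * (count S₁ + r)
        ≡⟨ split k (count S₁) r ⟩
      -- The share `2 * k * r` goes to the induction hypothesis; the share `2 * r` is paid for by
      -- the edges from the rest into `S₁`.
      2 * suc k * count S₁ + 2 * k * r + 2 * r
        ≤⟨ +-monoˡ-≤ (2 * r) (+-mono-≤ (*-monoʳ-≤ (2 * suc k) S₁≤s)
             (≤-trans bound₂ (+-monoˡ-≤ e′ (*-monoʳ-≤ (k * suc k) S₂≤s)))) ⟩
      2 * suc k * s + (k * suc k * s + e′) + 2 * r
        ≡⟨ regroup k s e′ r ⟩
      suc k * suc (suc k) * s + (e′ + 2 * r)
        ≤⟨ +-monoʳ-≤ _ (edgesIn-∖ S₁⊆T (λ v → max v (∈-allFin v))) ⟩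
      suc k * suc (suc k) * s + edgesIn T ∎
      where
      open ≤-Reasoning
      r = count (T ∖ S₁)
      e′ = edgesIn (T ∖ S₁)
      split : ∀ k a r → 2 * suc k * (a + r) ≡ 2 * suc k * a + 2 * k * r + 2 * r
      split = solve-∀
      regroup : ∀ k s e r → 2 * suc k * s + (k * suc k * s + e) + 2 * r
              ≡ suc k * suc (suc k) * s + (e + 2 * r)
      regroup = solve-∀

    larger : count S₁ ≤ count S₂ ⊎ count S₂ ≤ count S₁ →
      ∃[ S ] (InducedForest M S × 2 * suc k * count T ≤ suc k * suc (suc k) * count S + edgesIn T)
    larger (inj₁ S₁≤S₂) = S₂ , forest₂ , bound _ S₁≤S₂ ≤-refl
    larger (inj₂ S₂≤S₁) = S₁ , forest₁ , bound _ ≤-refl S₂≤S₁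

-- Plane embeddings: Euler's formula and the edge bound.

module _ {n : ℕ} {M : Multigraph n} where
  open Multigraph M

  isolated⇒degree≡0 : ∀ v → isolated M v ≡ true → degreeV M v ≡ 0
  isolated⇒degree≡0 v iso with degreeV M v
  ... | zero = refl

  tail⇒¬isolated : ∀ d → isolated M (tail M d) ≢ true
  tail⇒¬isolated (e , true) iso = 1+n≰n (≤-trans
    (≤-trans (1≤count _ e (≟-true (refl {x = src e}))) (m≤m+n _ _))
    (≤-reflexive (isolated⇒degree≡0 (src e) iso)))
  tail⇒¬isolated (e , false) iso = 1+n≰n (≤-trans
    (≤-trans (1≤count _ e (≟-true (refl {x = tgt e}))) (m≤n+m _ _))
    (≤-reflexive (isolated⇒degree≡0 (tgt e) iso)))

  isolated-connected : ∀ {u v} → isolated M u ≡ true → Connected M u v → u ≡ v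
  isolated-connected iso ε = refl
  isolated-connected iso ((e , inj₁ (refl , _)) ◅ _) = contradiction iso (tail⇒¬isolated (e , true))
  isolated-connected iso ((e , inj₂ (_ , refl)) ◅ _) = contradiction iso (tail⇒¬isolated (e , false))

  tail-flip : ∀ d → tail M (flip M d) ≢ tail M d
  tail-flip (e , true)  = noLoop e ∘ sym
  tail-flip (e , false) = noLoop e

  1≤countD : ∀ (Q : Dart M → Bool) d → Q d ≡ true → 1 ≤ countD M Q
  1≤countD Q (e , true)  Qd = ≤-trans (1≤count (λ e → Q (e , true)) e Qd) (m≤m+n _ _)
  1≤countD Q (e , false) Qd = ≤-trans (1≤count (λ e → Q (e , false)) e Qd) (m≤n+m _ _)

  2≤countD : ∀ (Q : Dart M → Bool) d d′ → d ≢ d′ → Q d ≡ true → Q d′ ≡ true → 2 ≤ countD M Q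
  2≤countD Q (e , true) (e′ , true) d≢d′ Qd Qd′ =
    ≤-trans (2≤count (λ e → Q (e , true)) e e′ (d≢d′ ∘ cong (_, true)) Qd Qd′) (m≤m+n _ _)
  2≤countD Q (e , false) (e′ , false) d≢d′ Qd Qd′ =
    ≤-trans (2≤count (λ e → Q (e , false)) e e′ (d≢d′ ∘ cong (_, false)) Qd Qd′) (m≤n+m _ _)
  2≤countD Q (e , true) (e′ , false) _ Qd Qd′ =
    +-mono-≤ (1≤count (λ e → Q (e , true)) e Qd) (1≤count (λ e → Q (e , false)) e′ Qd′)
  2≤countD Q (e , false) (e′ , true) _ Qd Qd′ =
    +-mono-≤ (1≤count (λ e → Q (e , true)) e′ Qd′) (1≤count (λ e → Q (e , false)) e Qd)

  module _ (E : PlaneEmbedding M) where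
    open PlaneEmbedding E

    -- Euler's formula for a plane graph with `k` components. The spherical formulas of the
    -- components add up to vertices plus component faces equal to `m + k * 2`; `tree-count` then
    -- trades component faces for plane faces.
    globalEuler : n + P ≡ m + k + 1
    globalEuler = +-cancelʳ-≡ (F + count (isolated M) + 1) (n + P) (m + k + 1) (begin-equality
      n + P + (F + count (isolated M) + 1)    ≡⟨ regroup n P (F + count (isolated M)) ⟩
      n + (F + count (isolated M)) + (P + 1)  ≡⟨ cong (_+ (P + 1)) summed ⟩
      m + k * 2 + (P + 1)                     ≡⟨ regroup′ m k P ⟩
      m + k + 1 + (k + P)                     ≡⟨ cong (m + k + 1 +_) tree-count ⟨
      m + k + 1 + (F + count (isolated M) + 1) ∎)
      where
      open ≤-Reasoning
      regroup : ∀ a b c → a + b + (c + 1) ≡ a + c + (b + 1)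
      regroup = solve-∀
      regroup′ : ∀ a b c → a + b * 2 + (c + 1) ≡ a + b + 1 + (b + c)
      regroup′ = solve-∀
      ∑Fc : sum Fc ≡ F + count (isolated M)
      ∑Fc = trans (∑-distrib-+ (λ c → count (λ f → ⌊ compF f ≟ c ⌋)) _)
        (cong₂ _+_ (trans (count-fibres (λ _ → true) compF) (count-true F))
                   (count-fibres (isolated M) comp))
      summed : n + (F + count (isolated M)) ≡ m + k * 2
      summed = begin-equality
        n + (F + count (isolated M))
          ≡⟨ cong₂ _+_ (trans (count-fibres (λ _ → true) comp) (count-true n)) ∑Fc ⟨
        sum Vc + sum Fc              ≡⟨ ∑-distrib-+ Vc Fc ⟨
        sum (λ c → Vc c + Fc c)      ≡⟨ sum-cong-≗ euler ⟩
        sum (λ c → Ec c + 2)         ≡⟨ ∑-distrib-+ Ec (λ _ → 2) ⟩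
        sum Ec + sum {k} (λ _ → 2)
          ≡⟨ cong₂ _+_ (trans (count-fibres (λ _ → true) (comp ∘ src)) (count-true m)) (sum-const k 2) ⟩
        m + k * 2                    ∎

    ∑faceDegree : sum faceDegree ≡ m + m
    ∑faceDegree = trans (∑-distrib-+ (λ p → count (λ e → ⌊ pfOrb (orb (e , true)) ≟ p ⌋)) _)
      (cong₂ _+_ (trans (count-fibres (λ _ → true) (λ e → pfOrb (orb (e , true)))) (count-true m))
                 (trans (count-fibres (λ _ → true) (λ e → pfOrb (orb (e , false)))) (count-true m)))

    -- A face without darts meets only isolated vertices, so in the incidence
    -- tree it and those vertices would form a whole component.
    OnlyIsolatedAround : Fin P → Fin k ⊎ Fin P → Set
    OnlyIsolatedAround p (inj₁ c) = ∃[ v ] (isolated M v ≡ true × comp v ≡ c × pfIso v ≡ p)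
    OnlyIsolatedAround p (inj₂ q) = q ≡ p

    dartOnFace : ∀ p → Dart M → ∃[ d ] pfOrb (orb d) ≡ p
    dartOnFace p d₀ = walk (inj₂ p) refl (tree-connected _ _)
      where
      -- The invariant is carried along a path from `p` to the face of `d₀`. It breaks only where a
      -- facial walk lies on `p`, which supplies a dart; if it survives to the end, the face of `d₀`
      -- is `p`.
      walk : ∀ x → OnlyIsolatedAround p x → Star BAdj x (inj₂ (pfOrb (orb d₀)))
           → ∃[ d ] pfOrb (orb d) ≡ p
      walk (inj₂ _) q≡p ε = d₀ , q≡p
      walk (inj₂ q) refl (_◅_ {j = inj₁ c} (inj₁ (f , _ , f≡p)) _) = rep f , trans (cong pfOrb (orb-rep f)) f≡p
      walk (inj₂ q) refl (_◅_ {j = inj₁ c} (inj₂ v) path) = walk (inj₁ c) v path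
      -- The component of an isolated vertex is that vertex alone. It has no facial walk, and its
      -- single face leads back to `p`.
      walk (inj₁ c) (v , iso , refl , refl) (_◅_ {j = inj₂ q} (inj₁ (f , f≡c , _)) _)
        with refl ← isolated-connected iso (Equivalence.to (comp-spec v _) (sym f≡c)) =
        contradiction iso (tail⇒¬isolated (rep f))
      walk (inj₁ c) (v , iso , refl , refl) (_◅_ {j = inj₂ q} (inj₂ (v′ , _ , v′≡c , v′≡q)) path)
        with refl ← isolated-connected iso (Equivalence.to (comp-spec v v′) (sym v′≡c)) =
        walk (inj₂ q) (sym v′≡q) path

    onFace : Fin P → Dart M → Bool
    onFace p d = ⌊ pfOrb (orb d) ≟ p ⌋

    -- A dart and its successor on the facial walk are distinct: `φ d` starts at the other end of
    -- the edge of `d`, and there are no loops. The dart argument rules out the edgeless case, where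
    -- a face has degree 0.
    2≤faceDegree : ∀ p → Dart M → 2 ≤ faceDegree p
    2≤faceDegree p d₀ with dartOnFace p d₀
    ... | d , refl = 2≤countD (onFace p) d (φ d) d≢φd (≟-true refl)
                       (≟-true (cong pfOrb (sym (Equivalence.from (orb-spec d (φ d)) (1 , refl)))))
      where
      d≢φd : d ≢ φ d
      d≢φd eq = tail-flip d (trans (sym (σ-tail (flip M d))) (cong (tail M) (sym eq)))

    -- Face degrees are at least 3, so three times the number of faces is at most `m + m`; Euler's
    -- formula does the rest. Adding `m + m` to both sides avoids subtraction. Some edge is
    -- required: a single vertex violates the bound.
    edgeBound : No2Faces → Fin m → m + 6 ≤ 3 * n
    edgeBound no2 e = +-cancelʳ-≤ (m + m) (m + 6) (3 * n) (begin
      -- The 6 is `3 * 1 + 3`, the case of one component; further components only help.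
      m + 6 + (m + m)                ≡⟨ regroup m ⟩
      3 * m + 3 * 1 + 3              ≤⟨ +-monoˡ-≤ 3 (+-monoʳ-≤ (3 * m) (*-monoʳ-≤ 3 (inhabited (comp (src e))))) ⟩
      3 * m + 3 * k + 3              ≡⟨ distrib m k ⟩
      3 * (m + k + 1)                ≡⟨ cong (3 *_) globalEuler ⟨
      3 * (n + P)                    ≡⟨ distrib′ n P ⟩
      3 * n + P * 3                  ≤⟨ +-monoʳ-≤ (3 * n) (*≤sum 3 3≤faceDegree) ⟩
      3 * n + sum faceDegree         ≡⟨ cong (3 * n +_) ∑faceDegree ⟩
      3 * n + (m + m)                ∎)
      where
      open ≤-Reasoning
      3≤faceDegree : ∀ p → 3 ≤ faceDegree p
      3≤faceDegree p = ≤∧≢⇒< (2≤faceDegree p (e , true)) (no2 p ∘ sym)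
      inhabited : ∀ {k} → Fin k → 1 ≤ k
      inhabited {suc k} _ = s≤s z≤n
      regroup : ∀ a → a + 6 + (a + a) ≡ 3 * a + 3 * 1 + 3
      regroup = solve-∀
      distrib : ∀ a b → 3 * a + 3 * b + 3 ≡ 3 * (a + b + 1)
      distrib = solve-∀
      distrib′ : ∀ a b → 3 * (a + b) ≡ 3 * a + b * 3
      distrib′ = solve-∀

-- Combining the two bounds.

fin? : ∀ k → Fin k ⊎ ¬ Fin k
fin? zero    = inj₂ λ ()
fin? (suc k) = inj₁ zero

theorem15 : ∀ {n : ℕ} (M : Multigraph n) → 1 ≤ n
    → (∃[ E ] PlaneEmbedding.No2Faces {M = M} E)
    → ∃[ S ] (InducedForest M S × 5 * n + 6 ≤ 20 * size M S)
theorem15 {n} M 1≤n (E , no2) with fin? (Multigraph.m M)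
... | inj₂ edgeless = (λ _ → true) , (λ C → edgeless (CycleIn.edge C zero)) , (begin
  5 * n + 6                        ≤⟨ +-monoʳ-≤ (5 * n) (≤-trans (m≤m+n 6 9) (*-monoʳ-≤ 15 1≤n)) ⟩
  5 * n + 15 * n                   ≡⟨ *-distribʳ-+ n 5 15 ⟨
  20 * n                           ≡⟨ cong (20 *_) (count-true n) ⟨
  20 * count {n} (λ _ → true)      ∎)
  where open ≤-Reasoning
-- Four stages give the coefficients 8 = 2 · 4 and 20 = 4 · 5; trading `m` for `3 * n` minus 6
-- leaves 8 - 3 = 5 on the left, hence the slope 5/20 = 1/4 and the constant 6/20 = 3/10.
... | inj₁ e with turánForest M 4 (λ _ → true)
...   | S , forest , bound = S , forest , +-cancelʳ-≤ (3 * n) (5 * n + 6) (20 * count S) (begin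
  5 * n + 6 + 3 * n                ≡⟨ regroup n ⟩
  8 * n + 6                        ≡⟨ cong (λ c → 8 * c + 6) (count-true n) ⟨
  8 * count {n} (λ _ → true) + 6   ≤⟨ +-monoˡ-≤ 6 bound ⟩
  20 * count S + edgesIn M (λ _ → true) + 6
    ≡⟨ cong (λ c → 20 * count S + c + 6) (count-true m) ⟩
  20 * count S + m + 6             ≡⟨ +-assoc (20 * count S) m 6 ⟩
  20 * count S + (m + 6)           ≤⟨ +-monoʳ-≤ (20 * count S) (edgeBound E no2 e) ⟩
  20 * count S + 3 * n             ∎)
  where
  open ≤-Reasoning
  open Multigraph M using (m)
  regroup : ∀ a → 5 * a + 6 + 3 * a ≡ 8 * a + 6
  regroup = solve-∀
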